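{- There is an absolute constant $c>0$ such that the following holds. Let $\delta>0$, let $\tau\ge1$ be an integer, $S_0>0$, $L>0$, let $\mathcal U=[-\underline{\zeta},\overline{\zeta}]$ with $0<\underline{\zeta}\le1$ and $\overline{\zeta}>0$, and let $g:\mathbb R\to\mathbb R$ be non-decreasing with $g(0)=0$ and $|g(x)-g(y)|\le L|x-y|$ for all $x,y$. Set $\epsilon=c\,\delta^2/(L^2\tau^2)$ and suppose that $(\underline{\zeta}+\overline{\zeta})/\epsilon$ is a positive integer. Then the multinomial tree approximation $\hat g_0(S_0)$ with step $\epsilon$ of the American option's price upper bound $g_0(S_0)$ satisfies $$g_0(S_0)-\delta S_0\le\hat g_0(S_0)\le g_0(S_0).$$
   Context: Exact American upper bound: $g_\tau(x)=g(x)$ and, for $t=\tau-1,\dots,0$, $$g_t(x)=\max\Bigl\{\min_{\Delta\in\mathbb R}\max_{R\in\mathcal U}\bigl[g_{t+1}(x(1+R))-R\Delta\bigr],\ g(x)\Bigr\}.$$ Multinomial tree approximation: let $\hat{\mathcal U}=\{ -\underline{\zeta},-\underline{\zeta}+\epsilon,\dots,\overline{\zeta}\}$. Put $\hat g_\tau(x)=g(x)$ and, for $t=\tau-1,\dots,0$, $$\hat g_t(x)=\max\Bigl\{\max_{P\in\mathcal P(\hat{\mathcal U}),\ \mathbb E_P[R]=0}\mathbb E_P[\hat g_{t+1}(x(1+R))],\ g(x)\Bigr\},$$ where $\mathcal P(\hat{\mathcal U})$ is the set of probability distributions on the finite set $\hat{\mathcal U}$ and $R$ has law $P$. -}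

module Defs where

open import Algebra.Bundles using (CommutativeRing)
open import Data.Fin.Base using (Fin; toℕ)
open import Data.Nat.Base as ℕ using (ℕ; suc)
open import Data.Product.Base using (Σ-syntax; ∃-syntax; _×_)
open import Level using (0ℓ) renaming (suc to lsuc)
open import Relation.Binary.Bundles using (TotalOrder)
open import Relation.Binary.Core using (Rel)
open import Relation.Binary.Structures using (IsDecTotalOrder)
open import Relation.Nullary using (¬_)
open import Relation.Unary using (Pred; U)

-- The library has no real numbers, so ℝ is given by its usual axioms: a
-- Dedekind-complete, totally (and, as in classical mathematics, decidably)
-- ordered field.  As always this characterises ℝ up to unique isomorphism.
record RealNumbers : Set (lsuc 0ℓ) where
  infix 4 _≤_ _<_
  infix 9 _⁻¹
  infixl 7 _/_
  field
    commutativeRing : CommutativeRing 0ℓ 0ℓ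

  open CommutativeRing commutativeRing public

  field
    _≤_             : Rel Carrier 0ℓ
    isDecTotalOrder : IsDecTotalOrder _≈_ _≤_
    0≉1             : ¬ (0# ≈ 1#)
    -- Total inverse with an unspecified value at 0#.
    _⁻¹             : Carrier → Carrier
    ⁻¹-cong         : ∀ {x y} → x ≈ y → x ⁻¹ ≈ y ⁻¹
    *-inverseʳ      : ∀ x → ¬ (x ≈ 0#) → x * x ⁻¹ ≈ 1#
    +-monoʳ-≤       : ∀ z {x y} → x ≤ y → z + x ≤ z + y
    *-nonNeg        : ∀ {x y} → 0# ≤ x → 0# ≤ y → 0# ≤ x * y

  IsUpperBound : Pred Carrier 0ℓ → Carrier → Set
  IsUpperBound A b = ∀ x → A x → x ≤ b

  field
    complete : (A : Pred Carrier 0ℓ) → (∃[ x ] A x) →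
               (∃[ b ] IsUpperBound A b) →
               ∃[ s ] IsUpperBound A s × (∀ b → IsUpperBound A b → s ≤ b)

  totalOrder : TotalOrder 0ℓ 0ℓ 0ℓ
  totalOrder = record
    { isTotalOrder = IsDecTotalOrder.isTotalOrder isDecTotalOrder }

  open import Algebra.Construct.NaturalChoice.Max totalOrder public using (_⊔_)
  open import Algebra.Properties.CommutativeMonoid.Sum +-commutativeMonoid
    public using (sum)
  open import Algebra.Properties.Semiring.Exp semiring public using (_^_)
  open import Algebra.Properties.Semiring.Mult semiring
    using () renaming (_×_ to _·_)

  _<_ : Rel Carrier 0ℓ
  x < y = x ≤ y × ¬ (x ≈ y)

  _/_ : Carrier → Carrier → Carrier
  x / y = x * y ⁻¹

  ∣_∣ : Carrier → Carrier
  ∣ x ∣ = x ⊔ (- x)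

  fromℕ : ℕ → Carrier
  fromℕ n = n · 1#

module AmericanOption (ℝ : RealNumbers) where
  open RealNumbers ℝ

  -- IsMax D f v: the maximum of f over the i satisfying D exists, i.e. is
  -- attained, and equals v.
  IsMax IsMin : {I : Set} → Pred I 0ℓ → (I → Carrier) → Carrier → Set
  IsMax D f v = (∃[ i ] D i × f i ≈ v) × (∀ i → D i → f i ≤ v)
  IsMin D f v = (∃[ i ] D i × f i ≈ v) × (∀ i → D i → v ≤ f i)

  -- v = min over j ∈ E of max over i ∈ D of f j i; the function m is the
  -- inner maximum.
  IsMinMax : {I J : Set} → Pred J 0ℓ → Pred I 0ℓ → (J → I → Carrier) →
             Carrier → Set
  IsMinMax {J = J} E D f v =
    Σ[ m ∈ (J → Carrier) ] (∀ j → E j → IsMax D (f j) (m j)) × IsMin E m v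

  NonDecreasing : (Carrier → Carrier) → Set
  NonDecreasing g = ∀ {x y} → x ≤ y → g x ≤ g y

  Lipschitz : Carrier → (Carrier → Carrier) → Set
  Lipschitz L g = ∀ x y → ∣ g x - g y ∣ ≤ L * ∣ x - y ∣

  -- [ a , b ] as a set of reals.
  Interval : Carrier → Carrier → Pred Carrier 0ℓ
  Interval a b R = a ≤ R × R ≤ b

  -- G t x is g_t(x), for 0 ≤ t ≤ τ and 𝒰 the set of possible returns; values
  -- of G at t > τ play no role.  Maxima and minima being unique up to ≈, this
  -- determines G t x for all t ≤ τ.
  IsUpperBoundPrice : (g : Carrier → Carrier) (𝒰 : Pred Carrier 0ℓ) (τ : ℕ) →
                      (ℕ → Carrier → Carrier) → Set
  IsUpperBoundPrice g 𝒰 τ G =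
    (∀ x → G τ x ≈ g x) ×
    (∀ t → t ℕ.< τ → ∀ x → ∃[ v ]
       IsMinMax U 𝒰 (λ Δ R → G (suc t) (x * (1# + R)) - R * Δ) v ×
       G t x ≈ v ⊔ g x)

  -- The points a, a + ε, …, a + Nε.
  grid : (a ε : Carrier) (N : ℕ) → Fin (suc N) → Carrier
  grid a ε N i = a + fromℕ (toℕ i) * ε

  -- Expectation of f(R), for R with values û i taken with probability P i.
  𝔼 : ∀ {n} → (û P : Fin n → Carrier) → (Carrier → Carrier) → Carrier
  𝔼 û P f = sum (λ i → P i * f (û i))

  IsDistribution : ∀ {n} → Pred (Fin n → Carrier) 0ℓ
  IsDistribution P = (∀ i → 0# ≤ P i) × sum P ≈ 1#

  IsMartingaleMeasure : ∀ {n} → (û : Fin n → Carrier) →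
                        Pred (Fin n → Carrier) 0ℓ
  IsMartingaleMeasure û P = IsDistribution P × 𝔼 û P (λ R → R) ≈ 0#

  -- As above, for the tree with set of returns { û i }, the û i being distinct.
  IsTreePrice : ∀ {n} (g : Carrier → Carrier) (û : Fin n → Carrier) (τ : ℕ) →
                (ℕ → Carrier → Carrier) → Set
  IsTreePrice g û τ Ĝ =
    (∀ x → Ĝ τ x ≈ g x) ×
    (∀ t → t ℕ.< τ → ∀ x → ∃[ v ]
       IsMax (IsMartingaleMeasure û)
             (λ P → 𝔼 û P (λ R → Ĝ (suc t) (x * (1# + R)))) v ×
       Ĝ t x ≈ v ⊔ g x)

{-# OPTIONS --safe #-}
-- With h R = f (x (1 + R)), the min-max over 𝒰 and the maximal expectation over
-- martingale measures on the grid are both superhedging prices: the least v such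
-- that h R ≤ v + R Δ for some Δ and all admissible R.  Duality holds because the
-- optimal measures may be taken supported on two points i, j with r i ≤ 0 < r j.
--
-- Prices are L-Lipschitz in x.  If (v , Δ) superhedges on the grid, then given R
-- choose, by the sign of Δ, the neighbouring grid point û with û Δ ≤ R Δ; then
-- h R ≤ h û + L x ε ≤ v + L x ε + R Δ, so (v + L x ε , Δ) superhedges on 𝒰.  A
-- single step thus costs L x ε, and a difference κ y of the two functions at the
-- next time adds κ x.  The total error is τ L ε S₀ = δ² S₀ / (L τ) for c = 1, at
-- most δ S₀ when δ ≤ L.  When δ ≥ L the bound is trivial, as g_0(S₀) ≤ L S₀ and
-- ĝ_0(S₀) ≥ g(S₀) ≥ 0.
module Submission where

open import Defs
import Algebra.Solver.Ring
open import Algebra.Solver.Ring.AlmostCommutativeRing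
  using (fromCommutativeRing; _-Raw-AlmostCommutative⟶_)
open import Data.Empty using (⊥-elim)
open import Data.Fin.Base using (Fin; zero; suc; toℕ; fromℕ<)
open import Data.Fin.Properties using (toℕ<n; toℕ-fromℕ<)
open import Data.Integer.Base as ℤ using (ℤ; +_; -[1+_])
import Data.Integer.Properties as ℤ
open import Data.List.Base using (allFin; cartesianProduct; filter)
open import Data.List.Membership.Propositional.Properties
  using (∈-allFin; ∈-cartesianProduct⁺; ∈-filter⁺)
import Data.List.Relation.Unary.All as All
open import Data.List.Relation.Unary.All.Properties using (all-filter)
open import Data.Maybe.Base using (Maybe; just; nothing)
open import Data.Nat.Base as ℕ using (ℕ; zero; suc)
import Data.Nat.Properties as ℕ
open import Data.Product.Base using (Σ-syntax; ∃-syntax; _×_; _,_; proj₁; proj₂)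
open import Data.Sum.Base using (_⊎_; inj₁; inj₂; [_,_]′)
open import Data.Unit.Base using (⊤)
open import Level using (0ℓ)
open import Relation.Binary.Core using (Rel)
open import Relation.Binary.PropositionalEquality.Core as ≡ using (_≡_)
open import Relation.Binary.Structures using (IsDecTotalOrder)
open import Relation.Nullary using (¬_; Dec; yes; no)
open import Relation.Nullary.Decidable using (decidable-stable)
open import Relation.Unary using (Pred; U)

-- Ordered field arithmetic, with a ring solver over the integers

module OrderedField (ℝ : RealNumbers) where
  open RealNumbers ℝ hiding (zero)
  open AmericanOption ℝ
  open import Algebra.Construct.NaturalChoice.Max totalOrder public
    using (x≤x⊔y; x≤y⊔x; ⊔-lub; ⊔-sel)
  open IsDecTotalOrder isDecTotalOrder public
    using (total; antisym; _≤?_; ≤-respʳ-≈; ≤-respˡ-≈)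
    renaming (refl to ≤-refl; trans to ≤-trans; reflexive to ≤-reflexive)
  open import Algebra.Properties.Ring ring using (-‿distribˡ-*; -‿distribʳ-*)
  open import Algebra.Properties.AbelianGroup +-abelianGroup
    using (ε⁻¹≈ε; xyx⁻¹≈y; ⁻¹-∙-comm; ⁻¹-involutive; x∙y⁻¹≈ε⇒x≈y)
  open import Algebra.Properties.Semiring.Mult.TCOptimised semiring
    using (×-homo-+; ×1-homo-*; 1+×) renaming (_×_ to _·′_)
  open import Relation.Binary.Reasoning.Setoid setoid

  -- With the multiple `·′`, the coefficients `con (+ 0)` and `con (+ 1)` denote `0#` and `1#`
  -- definitionally, so solved identities fit the goals as they stand.
  fromℤ : ℤ → Carrier
  fromℤ (+ n)    = n ·′ 1#
  fromℤ -[1+ n ] = - (suc n ·′ 1#)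

  fromℤ-⊖ : ∀ m n → fromℤ (m ℤ.⊖ n) ≈ m ·′ 1# - n ·′ 1#
  fromℤ-⊖ zero    zero    = sym (-‿inverseʳ 0#)
  fromℤ-⊖ zero    (suc n) = sym (+-identityˡ _)
  fromℤ-⊖ (suc m) zero    = sym (trans (+-congˡ ε⁻¹≈ε) (+-identityʳ _))
  fromℤ-⊖ (suc m) (suc n) = begin
    fromℤ (suc m ℤ.⊖ suc n)              ≡⟨ ≡.cong fromℤ (ℤ.[1+m]⊖[1+n]≡m⊖n m n) ⟩
    fromℤ (m ℤ.⊖ n)                      ≈⟨ fromℤ-⊖ m n ⟩
    m ·′ 1# - n ·′ 1#                    ≈⟨ +-congʳ (xyx⁻¹≈y 1# _) ⟨
    ((1# + m ·′ 1#) - 1#) - n ·′ 1#      ≈⟨ +-assoc _ _ _ ⟩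
    (1# + m ·′ 1#) + (- 1# - n ·′ 1#)    ≈⟨ +-congˡ (⁻¹-∙-comm 1# _) ⟩
    (1# + m ·′ 1#) - (1# + n ·′ 1#)      ≈⟨ +-cong (1+× m 1#) (-‿cong (1+× n 1#)) ⟨
    suc m ·′ 1# - suc n ·′ 1#            ∎

  fromℤ-neg : ∀ i → fromℤ (ℤ.- i) ≈ - fromℤ i
  fromℤ-neg (+ zero)  = sym ε⁻¹≈ε
  fromℤ-neg (+ suc n) = refl
  fromℤ-neg -[1+ n ]  = sym (⁻¹-involutive _)

  fromℤ-+ : ∀ i j → fromℤ (i ℤ.+ j) ≈ fromℤ i + fromℤ j
  fromℤ-+ (+ m)    (+ n)    = ×-homo-+ 1# m n
  fromℤ-+ (+ m)    -[1+ n ] = fromℤ-⊖ m (suc n)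
  fromℤ-+ -[1+ m ] (+ n)    = trans (fromℤ-⊖ n (suc m)) (+-comm _ _)
  fromℤ-+ -[1+ m ] -[1+ n ] = begin
    - (suc (suc (m ℕ.+ n)) ·′ 1#)      ≡⟨ ≡.cong (λ k → - (suc k ·′ 1#)) (≡.sym (ℕ.+-suc m n)) ⟩
    - ((suc m ℕ.+ suc n) ·′ 1#)        ≈⟨ -‿cong (×-homo-+ 1# (suc m) (suc n)) ⟩
    - (suc m ·′ 1# + suc n ·′ 1#)      ≈⟨ ⁻¹-∙-comm _ _ ⟨
    - (suc m ·′ 1#) - suc n ·′ 1#      ∎

  fromℤ-*-pos : ∀ m j → fromℤ (+ m ℤ.* j) ≈ fromℤ (+ m) * fromℤ j
  fromℤ-*-pos m (+ n) = begin
    fromℤ (+ m ℤ.* + n)  ≡⟨ ≡.cong fromℤ (≡.sym (ℤ.pos-* m n)) ⟩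
    (m ℕ.* n) ·′ 1#      ≈⟨ ×1-homo-* m n ⟩
    m ·′ 1# * n ·′ 1#    ∎
  fromℤ-*-pos m -[1+ n ] = begin
    fromℤ (+ m ℤ.* -[1+ n ])         ≡⟨ ≡.cong fromℤ (≡.sym (ℤ.neg-distribʳ-* (+ m) (+ suc n))) ⟩
    fromℤ (ℤ.- (+ m ℤ.* + suc n))    ≈⟨ fromℤ-neg (+ m ℤ.* + suc n) ⟩
    - fromℤ (+ m ℤ.* + suc n)        ≈⟨ -‿cong (fromℤ-*-pos m (+ suc n)) ⟩
    - (m ·′ 1# * suc n ·′ 1#)        ≈⟨ -‿distribʳ-* _ _ ⟩
    m ·′ 1# * - (suc n ·′ 1#)        ∎

  fromℤ-* : ∀ i j → fromℤ (i ℤ.* j) ≈ fromℤ i * fromℤ j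
  fromℤ-* (+ m)    j = fromℤ-*-pos m j
  fromℤ-* -[1+ m ] j = begin
    fromℤ (-[1+ m ] ℤ.* j)           ≡⟨ ≡.cong fromℤ (≡.sym (ℤ.neg-distribˡ-* (+ suc m) j)) ⟩
    fromℤ (ℤ.- (+ suc m ℤ.* j))      ≈⟨ fromℤ-neg (+ suc m ℤ.* j) ⟩
    - fromℤ (+ suc m ℤ.* j)          ≈⟨ -‿cong (fromℤ-*-pos (suc m) j) ⟩
    - (suc m ·′ 1# * fromℤ j)        ≈⟨ -‿distribˡ-* _ _ ⟩
    - (suc m ·′ 1#) * fromℤ j        ∎

  fromℤ-homo : ℤ.+-*-rawRing -Raw-AlmostCommutative⟶ fromCommutativeRing commutativeRing
  fromℤ-homo = record
    { ⟦_⟧    = fromℤ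
    ; +-homo = fromℤ-+
    ; *-homo = fromℤ-*
    ; -‿homo = fromℤ-neg
    ; 0-homo = refl
    ; 1-homo = refl
    }

  coefficients≟ : ∀ i j → Maybe (fromℤ i ≈ fromℤ j)
  coefficients≟ i j with i ℤ.≟ j
  ... | yes i≡j = just (reflexive (≡.cong fromℤ i≡j))
  ... | no  _   = nothing

  -- Integer coefficients, unlike elements of the field, have an equality test
  -- that computes; the solver needs it to see cancellations.
  open Algebra.Solver.Ring ℤ.+-*-rawRing (fromCommutativeRing commutativeRing)
    fromℤ-homo coefficients≟ public
    using (solve; con; _:+_; _:*_; _:-_; :-_; _:=_)

  -- Inequalities and division

  0≤- : ∀ {x y} → x ≤ y → 0# ≤ y - x
  0≤- {x} {y} x≤y = ≤-respˡ-≈ (-‿inverseˡ x) (≤-respʳ-≈ (+-comm (- x) y) (+-monoʳ-≤ (- x) x≤y))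

  -- Inequalities are derived from nonnegativity certificates: y - x is written
  -- as a combination s of nonnegative terms, by a ring identity.
  ≤-by : ∀ {x y s} → 0# ≤ s → s ≈ y - x → x ≤ y
  ≤-by {x} {y} 0≤s s≈y-x = ≤-respˡ-≈ (+-identityʳ x)
    (≤-respʳ-≈ (solve 2 (λ x y → x :+ (y :- x) := y) refl x y)
      (+-monoʳ-≤ x (≤-respʳ-≈ s≈y-x 0≤s)))

  0≤+ : ∀ {x y} → 0# ≤ x → 0# ≤ y → 0# ≤ x + y
  0≤+ {x} {y} 0≤x 0≤y = ≤-trans 0≤x (≤-respˡ-≈ (+-identityʳ x) (+-monoʳ-≤ x 0≤y))

  ≰⇒≥ : ∀ {x y} → ¬ (x ≤ y) → y ≤ x
  ≰⇒≥ {x} {y} x≰y with total x y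
  ... | inj₁ x≤y = ⊥-elim (x≰y x≤y)
  ... | inj₂ y≤x = y≤x

  ≰⇒> : ∀ {x y} → ¬ (x ≤ y) → y < x
  ≰⇒> x≰y = ≰⇒≥ x≰y , λ y≈x → x≰y (≤-reflexive (sym y≈x))

  <⇒≱ : ∀ {x y} → x < y → ¬ (y ≤ x)
  <⇒≱ (x≤y , x≉y) y≤x = x≉y (antisym x≤y y≤x)

  -- Decidability of the order allows proofs of inequalities by contradiction, as in the attainment
  -- of maxima.
  ≤-stable : ∀ {x y} → ¬ ¬ (x ≤ y) → x ≤ y
  ≤-stable {x} {y} = decidable-stable (x ≤? y)

  <-≤-trans : ∀ {x y z} → x < y → y ≤ z → x < z
  <-≤-trans (x≤y , x≉y) y≤z =
    ≤-trans x≤y y≤z , λ x≈z → x≉y (antisym x≤y (≤-respʳ-≈ (sym x≈z) y≤z))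

  0<⇒≉0 : ∀ {x} → 0# < x → ¬ (x ≈ 0#)
  0<⇒≉0 (_ , 0≉x) x≈0 = 0≉x (sym x≈0)

  0<- : ∀ {x y} → x < y → 0# < y - x
  0<- {x} {y} (x≤y , x≉y) = 0≤- x≤y , λ 0≈y-x →
    x≉y (sym (x∙y⁻¹≈ε⇒x≈y y x (sym 0≈y-x)))

  0≤1 : 0# ≤ 1#
  0≤1 with total 0# 1#
  ... | inj₁ 0≤1 = 0≤1
  ... | inj₂ 1≤0 = ≤-respʳ-≈
    (solve 0 ((con (+ 0) :- con (+ 1)) :* (con (+ 0) :- con (+ 1)) := con (+ 1)) refl)
    (*-nonNeg (0≤- 1≤0) (0≤- 1≤0))

  0<1 : 0# < 1#
  0<1 = 0≤1 , 0≉1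

  0<+ : ∀ {x y} → 0# ≤ x → 0# < y → 0# < x + y
  0<+ {x} {y} 0≤x 0<y = <-≤-trans 0<y
    (≤-by 0≤x (solve 2 (λ x y → x := (x :+ y) :- y) refl x y))

  *-cancelʳ : ∀ {x z} → 0# < z → x * z * z ⁻¹ ≈ x
  *-cancelʳ {x} {z = z} 0<z =
    trans (*-assoc _ _ _) (trans (*-congˡ (*-inverseʳ z (0<⇒≉0 0<z))) (*-identityʳ x))

  /-* : ∀ {x z} → 0# < z → x / z * z ≈ x
  /-* {x} {z} 0<z = trans
    (solve 3 (λ x z w → x :* w :* z := x :* z :* w) refl x z (z ⁻¹)) (*-cancelʳ 0<z)

  0<* : ∀ {x y} → 0# < x → 0# < y → 0# < x * y
  0<* {x} {y} 0<x 0<y = *-nonNeg (proj₁ 0<x) (proj₁ 0<y) , λ 0≈xy →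
    proj₂ 0<x (trans (sym (zeroˡ (y ⁻¹))) (trans (*-congʳ 0≈xy) (*-cancelʳ 0<y)))

  -- Otherwise `x * (0# - x ⁻¹)`, which equals `0# - 1#`, would be nonnegative.
  0<⁻¹ : ∀ {x} → 0# < x → 0# < x ⁻¹
  0<⁻¹ {x} 0<x = ≰⇒> λ x⁻¹≤0 → <⇒≱ 0<1
    (≤-by (*-nonNeg (proj₁ 0<x) (0≤- x⁻¹≤0))
      (trans (solve 2 (λ x w → x :* (con (+ 0) :- w) := con (+ 0) :- x :* w) refl x (x ⁻¹))
        (+-congˡ (-‿cong (*-inverseʳ x (0<⇒≉0 0<x))))))

  *-cancelʳ-≤ : ∀ {x y z} → 0# < z → x * z ≤ y * z → x ≤ y
  *-cancelʳ-≤ {x} {y} {z} 0<z xz≤yz = ≤-by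
    (*-nonNeg (0≤- xz≤yz) (proj₁ (0<⁻¹ 0<z)))
    (trans
      (solve 4 (λ x y z w → (y :* z :- x :* z) :* w := (y :- x) :* z :* w) refl x y z (z ⁻¹))
      (*-cancelʳ 0<z))

  *-monoˡ-≤ : ∀ {x y z} → 0# ≤ z → x ≤ y → z * x ≤ z * y
  *-monoˡ-≤ {x} {y} {z} 0≤z x≤y = ≤-by (*-nonNeg 0≤z (0≤- x≤y))
    (solve 3 (λ x y z → z :* (y :- x) := z :* y :- z :* x) refl x y z)

  +-monoˡ-≤ : ∀ {x y z} → x ≤ y → x + z ≤ y + z
  +-monoˡ-≤ {x} {y} {z} x≤y = ≤-respˡ-≈ (+-comm z x) (≤-respʳ-≈ (+-comm z y) (+-monoʳ-≤ z x≤y))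

  0≤fromℕ : ∀ n → 0# ≤ fromℕ n
  0≤fromℕ zero    = ≤-refl
  0≤fromℕ (suc n) = 0≤+ 0≤1 (0≤fromℕ n)

  fromℕ-mono-≤ : ∀ {m n} → m ℕ.≤ n → fromℕ m ≤ fromℕ n
  fromℕ-mono-≤ {n = n} ℕ.z≤n = 0≤fromℕ n
  fromℕ-mono-≤ (ℕ.s≤s m≤n)   = +-monoʳ-≤ 1# (fromℕ-mono-≤ m≤n)

  -- Distances and Lipschitz functions

  0≤x+x⇒0≤x : ∀ {x} → 0# ≤ x + x → 0# ≤ x
  0≤x+x⇒0≤x {x} 0≤x+x with total 0# x
  ... | inj₁ 0≤x = 0≤x
  ... | inj₂ x≤0 = ≤-by (0≤+ 0≤x+x (0≤- x≤0))
    (solve 1 (λ x → x :+ x :+ (con (+ 0) :- x) := x :- con (+ 0)) refl x)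

  0≤∣x∣ : ∀ x → 0# ≤ ∣ x ∣
  0≤∣x∣ x with total 0# x
  ... | inj₁ 0≤x = ≤-trans 0≤x (x≤x⊔y x (- x))
  ... | inj₂ x≤0 = ≤-trans (≤-respʳ-≈ (+-identityˡ _) (0≤- x≤0)) (x≤y⊔x x (- x))

  -- Stands for `∣ y - z ∣ ≤ d`, split into two inequalities that can enter nonnegativity
  -- certificates directly.
  Near : Carrier → Rel Carrier 0ℓ
  Near d y z = y ≤ z + d × z ≤ y + d

  near-sym : ∀ {d y z} → Near d y z → Near d z y
  near-sym (p , q) = q , p

  -- The sign of `x` is unknown, so the two inequalities are weighted with `∣ x ∣ - x` and
  -- `∣ x ∣ + x`, both nonnegative; the sum is twice the difference sought.
  near-*ˡ : ∀ x {d y z} → Near d y z → Near (∣ x ∣ * d) (x * y) (x * z)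
  near-*ˡ x {d} {y} {z} near = half near , half (near-sym near)
    where
    m = ∣ x ∣
    half : ∀ {y z} → Near d y z → x * y ≤ x * z + m * d
    half {y} {z} (y≤z+d , z≤y+d) = ≤-by
      (0≤x+x⇒0≤x (≤-respʳ-≈
        (solve 5 (λ x m d y z →
          (m :- x) :* (y :+ d :- z) :+ (m :- (:- x)) :* (z :+ d :- y)
            := (x :* z :+ m :* d :- x :* y) :+ (x :* z :+ m :* d :- x :* y))
          refl x m d y z)
        (0≤+ (*-nonNeg (0≤- (x≤x⊔y x (- x))) (0≤- z≤y+d))
             (*-nonNeg (0≤- (x≤y⊔x x (- x))) (0≤- y≤z+d)))))
      refl

  near-nonNeg-*ˡ : ∀ {x d y z} → 0# ≤ x → Near d y z → Near (x * d) (x * y) (x * z)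
  near-nonNeg-*ˡ {x} 0≤x (p , q) = half p , half q
    where
    half : ∀ {d y z} → y ≤ z + d → x * y ≤ x * z + x * d
    half {d} {y} {z} p = ≤-respʳ-≈ (distribˡ x z d) (*-monoˡ-≤ 0≤x p)

  near-*ʳ : ∀ {x d y z} → 0# ≤ x → Near d y z → Near (d * x) (y * x) (z * x)
  near-*ʳ {x} 0≤x (p , q) = half p , half q
    where
    half : ∀ {d y z} → y ≤ z + d → y * x ≤ z * x + d * x
    half {d} {y} {z} p = ≤-respʳ-≈ (distribʳ x z d)
      (≤-respˡ-≈ (*-comm x y) (≤-respʳ-≈ (*-comm x (z + d)) (*-monoˡ-≤ 0≤x p)))

  near-+ˡ : ∀ w {d y z} → Near d y z → Near d (w + y) (w + z)
  near-+ˡ w (p , q) = half p , half q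
    where
    half : ∀ {d y z} → y ≤ z + d → w + y ≤ w + z + d
    half {d} {y} {z} p = ≤-respʳ-≈ (sym (+-assoc w z d)) (+-monoʳ-≤ w p)

  -- One-sided, and with any bound `d` on the distance in place of the distance; exchanging `x` and
  -- `y` gives the other side.
  LipschitzBound : Carrier → (Carrier → Carrier) → Set
  LipschitzBound K f = ∀ {x y d} → 0# ≤ d → Near d x y → f x ≤ f y + K * d

  lipschitz⇒bound : ∀ {K f} → 0# ≤ K → Lipschitz K f → LipschitzBound K f
  lipschitz⇒bound {K} {f} 0≤K lip {x} {y} {d} 0≤d (x≤y+d , y≤x+d) = ≤-by
    (0≤+ (0≤- (≤-trans (x≤x⊔y _ _) (lip x y))) (0≤- (*-monoˡ-≤ 0≤K ∣x-y∣≤d)))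
    (solve 5 (λ fx fy K a d →
      (K :* a :- (fx :- fy)) :+ (K :* d :- K :* a) := fy :+ K :* d :- fx)
      refl (f x) (f y) K ∣ x - y ∣ d)
    where
    ∣x-y∣≤d : ∣ x - y ∣ ≤ d
    ∣x-y∣≤d = ⊔-lub
      (≤-by (0≤- x≤y+d) (solve 3 (λ x y d → y :+ d :- x := d :- (x :- y)) refl x y d))
      (≤-by (0≤- y≤x+d) (solve 3 (λ x y d → x :+ d :- y := d :- (:- (x :- y))) refl x y d))

  -- The maximiser is the last point x such that the supremum over [ a , b ] is
  -- still approached on [ x , b ].
  lipschitz-attains-max : ∀ {K f a b} → 0# ≤ K → LipschitzBound K f → a ≤ b →
    ∃[ x ] Interval a b x × (∀ y → Interval a b y → f y ≤ f x)
  lipschitz-attains-max {K} {f} {a} {b} 0≤K lip a≤b =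
    x* , (a≤x* , x*≤b) , λ y y∈ → ≤-trans (f≤M y y∈) M≤fx*
    where
    sup-f : ∃[ s ] IsUpperBound (λ s → ∃[ y ] Interval a b y × s ≈ f y) s ×
              (∀ u → IsUpperBound (λ s → ∃[ y ] Interval a b y × s ≈ f y) u → s ≤ u)
    sup-f = complete _ (f a , a , (≤-refl , a≤b) , refl)
      (f a + K * (b - a) , λ { s (y , (a≤y , y≤b) , s≈fy) → ≤-respˡ-≈ (sym s≈fy)
        (lip (0≤- a≤b)
          ( ≤-by (0≤- y≤b) (solve 3 (λ a b y → b :- y := a :+ (b :- a) :- y) refl a b y)
          , ≤-by (0≤+ (0≤- a≤y) (0≤- a≤b))
              (solve 3 (λ a b y → (y :- a) :+ (b :- a) := y :+ (b :- a) :- a) refl a b y))) })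
    M = proj₁ sup-f

    f≤M : ∀ y → Interval a b y → f y ≤ M
    f≤M y y∈ = proj₁ (proj₂ sup-f) _ (y , y∈ , refl)

    Late : Pred Carrier 0ℓ
    Late x = Interval a b x × (∀ u → (∀ y → Interval x b y → f y ≤ u) → M ≤ u)

    late-a : Late a
    late-a = (≤-refl , a≤b) , λ u f≤u →
      proj₂ (proj₂ sup-f) u (λ { s (y , y∈ , s≈fy) → ≤-respˡ-≈ (sym s≈fy) (f≤u y y∈) })

    sup-late : ∃[ s ] IsUpperBound Late s × (∀ u → IsUpperBound Late u → s ≤ u)
    sup-late = complete Late (a , late-a) (b , λ x late → proj₂ (proj₁ late))
    x* = proj₁ sup-late

    a≤x* : a ≤ x*
    a≤x* = proj₁ (proj₂ sup-late) a late-a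

    x*≤b : x* ≤ b
    x*≤b = proj₂ (proj₂ sup-late) b (λ x late → proj₂ (proj₁ late))

    module _ (M≰fx* : ¬ (M ≤ f x*)) where
      K+1 = K + 1#
      0<K+1 = 0<+ 0≤K 0<1
      -- Chosen so that `K * η` falls short of the gap `M - f x*` by exactly `η`; hence `u₀` lies
      -- strictly below `M`.
      η = (M - f x*) / K+1
      0<η : 0# < η
      0<η = 0<* (0<- (≰⇒> M≰fx*)) (0<⁻¹ 0<K+1)
      u₀ = f x* + K * η

      M≰u₀ : ¬ (M ≤ u₀)
      M≰u₀ M≤u₀ = <⇒≱ 0<η (≤-by (0≤- M≤u₀)
        (trans (solve 4 (λ M fx K η → fx :+ K :* η :- M := (η :* (K :+ con (+ 1)) :- (M :- fx)) :- η)
                 refl M (f x*) K η)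
          (+-congʳ (trans (+-congʳ (/-* 0<K+1)) (-‿inverseʳ _)))))

      near⇒≤u₀ : ∀ y → x* - η ≤ y → y ≤ x* + η → f y ≤ u₀
      near⇒≤u₀ y p q = lip (proj₁ 0<η)
        (q , ≤-by (0≤- p) (solve 3 (λ x y η → y :- (x :- η) := y :+ η :- x) refl x* y η))

      -- Suppose that `x` is late and `x* - η ≤ x`. If `b` lies before `x* + η`, then `f` is at most
      -- `u₀` from `x` to `b`, contradicting lateness. Otherwise `x* + η` is late too, beyond the
      -- supremum `x*`.
      early : IsUpperBound Late (x* - η)
      early x ((a≤x , x≤b) , late) = ≤-stable λ x≰ → absurd (≰⇒≥ x≰)
        where
        absurd : ¬ (x* - η ≤ x)
        absurd x*-η≤x with (x* + η) ≤? b
        ... | no  x*+η≰b = M≰u₀ (late u₀ λ { y (x≤y , y≤b) →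
          near⇒≤u₀ y (≤-trans x*-η≤x x≤y) (≤-trans y≤b (≰⇒≥ x*+η≰b)) })
        ... | yes x*+η≤b = <⇒≱ 0<η (≤-by (0≤- (proj₁ (proj₂ sup-late) (x* + η) late-x*+η))
          (solve 2 (λ x η → x :- (x :+ η) := con (+ 0) :- η) refl x* η))
          where
          late-x*+η : Late (x* + η)
          late-x*+η =
            (≤-trans a≤x* (≤-by (proj₁ 0<η) (solve 2 (λ x η → η := x :+ η :- x) refl x* η)) , x*+η≤b) ,
            λ u f≤u →
              -- Up to `x* + η` the values are at most `u₀`, from there on at most `u`; by `M≰u₀`
              -- the larger of the two must be `u`.
              let M≤u⊔u₀ = late (u ⊔ u₀) λ { y (x≤y , y≤b) →
                    [ (λ y≤ → ≤-trans (near⇒≤u₀ y (≤-trans x*-η≤x x≤y) y≤) (x≤y⊔x u u₀))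
                    , (λ ≤y → ≤-trans (f≤u y (≤y , y≤b)) (x≤x⊔y u u₀)) ]′ (total y (x* + η)) }
              in [ (λ ≈u → ≤-respʳ-≈ ≈u M≤u⊔u₀)
                 , (λ ≈u₀ → ⊥-elim (M≰u₀ (≤-respʳ-≈ ≈u₀ M≤u⊔u₀))) ]′ (⊔-sel u u₀)

      absurd : _
      absurd = <⇒≱ 0<η (≤-by (0≤- (proj₂ (proj₂ sup-late) _ early))
        (solve 2 (λ x η → x :- η :- x := con (+ 0) :- η) refl x* η))

    M≤fx* : M ≤ f x*
    M≤fx* = ≤-stable absurd

-- Superhedging and two-point martingale measures

module Duality (ℝ : RealNumbers) where
  open RealNumbers ℝ hiding (zero)
  open AmericanOption ℝ
  open OrderedField ℝ
  open import Relation.Binary.Reasoning.Setoid setoid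
  open import Algebra.Properties.CommutativeMonoid.Sum +-commutativeMonoid
    using (∑-distrib-+; sum-cong-≋; sum-replicate-zero)
  open import Data.List.Extrema totalOrder using (argmax; argmax-all; f[xs]≤f[argmax])
  open import Algebra.Properties.Semiring.Sum semiring using (*-distribʳ-sum; *-distribˡ-sum)

  Superhedges : {I : Set} → Pred I 0ℓ → (r h : I → Carrier) → Carrier → Carrier → Set
  Superhedges D r h v Δ = ∀ i → D i → h i ≤ v + r i * Δ

  IsSuperhedgingPrice : {I : Set} → Pred I 0ℓ → (r h : I → Carrier) → Carrier → Set
  IsSuperhedgingPrice D r h v =
    (∃[ Δ ] Superhedges D r h v Δ) × (∀ v′ Δ → Superhedges D r h v′ Δ → v ≤ v′)

  bounded⇒superhedges : ∀ {I : Set} {D : Pred I 0ℓ} {r h m Δ} →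
    (∀ i → D i → h i - r i * Δ ≤ m) → Superhedges D r h m Δ
  bounded⇒superhedges {r = r} {h} {m} {Δ} bounded i Di = ≤-by (0≤- (bounded i Di))
    (solve 4 (λ m h r Δ → m :- (h :- r :* Δ) := m :+ r :* Δ :- h) refl m (h i) (r i) Δ)

  -- For fixed `Δ`, the least capital that superhedges is the inner maximum of `h - r Δ`.
  minMax⇒price : ∀ {I : Set} {D : Pred I 0ℓ} {r h v} →
    IsMinMax U D (λ Δ i → h i - r i * Δ) v → IsSuperhedgingPrice D r h v
  minMax⇒price {D = D} {r} {h} {v} (m , max , (Δ₀ , _ , mΔ₀≈v) , v≤m) =
    (Δ₀ , bounded⇒superhedges (λ i Di → ≤-respʳ-≈ mΔ₀≈v (proj₂ (max Δ₀ _) i Di))) ,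
    λ v′ Δ sh → ≤-trans (v≤m Δ _)
      (let ((i , Di , ≈mΔ) , _) = max Δ _ in
       ≤-respˡ-≈ ≈mΔ (≤-by (0≤- (sh i Di))
         (solve 4 (λ v h r Δ → v :+ r :* Δ :- h := v :- (h :- r :* Δ)) refl v′ (h i) (r i) Δ)))

  -- Conversely the inner maxima have to be attained for every `Δ`, which `argmax` provides.
  price⇒minMax : ∀ {I : Set} {D : Pred I 0ℓ} {r h v} →
    (∀ Δ → ∃[ i ] D i × (∀ j → D j → h j - r j * Δ ≤ h i - r i * Δ)) →
    IsSuperhedgingPrice D r h v → IsMinMax U D (λ Δ i → h i - r i * Δ) v
  price⇒minMax {D = D} {r} {h} {v} argmax ((Δ₀ , sh₀) , minimal) =
    m , (λ Δ _ → (best Δ , proj₁ (proj₂ (argmax Δ)) , refl) , proj₂ (proj₂ (argmax Δ))) ,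
    (Δ₀ , _ , antisym mΔ₀≤v (v≤m Δ₀)) , λ Δ _ → v≤m Δ
    where
    best = λ Δ → proj₁ (argmax Δ)
    m : Carrier → Carrier
    m Δ = h (best Δ) - r (best Δ) * Δ
    v≤m : ∀ Δ → v ≤ m Δ
    v≤m Δ = minimal (m Δ) Δ (bounded⇒superhedges (proj₂ (proj₂ (argmax Δ))))
    mΔ₀≤v : m Δ₀ ≤ v
    mΔ₀≤v = ≤-by (0≤- (sh₀ (best Δ₀) (proj₁ (proj₂ (argmax Δ₀)))))
      (solve 4 (λ v h r Δ → v :+ r :* Δ :- h := v :- (h :- r :* Δ))
        refl v (h (best Δ₀)) (r (best Δ₀)) Δ₀)

  module TwoPoint {I : Set} (D : Pred I 0ℓ) (r : I → Carrier) where

    -- Only one inequality is strict: a point with return zero may serve as `i`, and `r j - r i` is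
    -- still positive.
    Straddles : I → I → Set
    Straddles i j = (D i × r i ≤ 0#) × (D j × 0# < r j)

    ArbitrageFree : Set
    ArbitrageFree = (∃[ i ] D i × r i < 0#) × (∃[ j ] D j × 0# < r j)

    -- For straddling points, the probabilities of `i` and `j` under the only law on these two
    -- points that gives `r` mean zero.
    weightˡ weightʳ : I → I → Carrier
    weightˡ i j = r j / (r j - r i)
    weightʳ i j = (- r i) / (r j - r i)

    -- The height at return zero of the line through `(r i , h i)` and `(r j , h j)`.
    chord : (I → Carrier) → I → I → Carrier
    chord h i j = weightˡ i j * h i + weightʳ i j * h j

    module _ {i j} (straddles : Straddles i j) where
      private
        rᵢ≤0 = proj₂ (proj₁ straddles)
        0<rⱼ = proj₂ (proj₂ straddles)
        w = (r j - r i) ⁻¹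

      0≤-rᵢ : 0# ≤ - r i
      0≤-rᵢ = ≤-respʳ-≈ (+-identityˡ _) (0≤- rᵢ≤0)

      0<span : 0# < r j - r i
      0<span = <-≤-trans 0<rⱼ (≤-by 0≤-rᵢ
        (solve 2 (λ a b → :- a := b :- a :- b) refl (r i) (r j)))

      0≤weightˡ : 0# ≤ weightˡ i j
      0≤weightˡ = *-nonNeg (proj₁ 0<rⱼ) (proj₁ (0<⁻¹ 0<span))

      0≤weightʳ : 0# ≤ weightʳ i j
      0≤weightʳ = *-nonNeg 0≤-rᵢ (proj₁ (0<⁻¹ 0<span))

      weights-sum : weightˡ i j + weightʳ i j ≈ 1#
      weights-sum = trans
        (solve 3 (λ a b w → b :* w :+ (:- a) :* w := (b :- a) :* w) refl (r i) (r j) w)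
        (*-inverseʳ _ (0<⇒≉0 0<span))

      weights-mean : weightˡ i j * r i + weightʳ i j * r j ≈ 0#
      weights-mean = solve 3 (λ a b w → b :* w :* a :+ (:- a) :* w :* b := con (+ 0))
        refl (r i) (r j) w

      -- Weak duality: averaging the superhedging inequalities at `i` and `j` with the weights
      -- removes `Δ`, since the weighted mean of the returns is zero.
      chord≤superhedge : ∀ {h v Δ} → Superhedges D r h v Δ → chord h i j ≤ v
      chord≤superhedge {h} {v} {Δ} sh = ≤-by
        (0≤+ (*-nonNeg 0≤weightˡ (0≤- (sh i (proj₁ (proj₁ straddles)))))
             (*-nonNeg 0≤weightʳ (0≤- (sh j (proj₁ (proj₂ straddles))))))
        (trans
          (solve 8 (λ p q a b x y v Δ →
            p :* (v :+ a :* Δ :- x) :+ q :* (v :+ b :* Δ :- y)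
              := (p :+ q) :* v :+ (p :* a :+ q :* b) :* Δ :- (p :* x :+ q :* y))
            refl (weightˡ i j) (weightʳ i j) (r i) (r j) (h i) (h j) v Δ)
          (trans (+-congʳ (+-cong (*-congʳ weights-sum) (*-congʳ weights-mean)))
            (solve 3 (λ v Δ c → con (+ 1) :* v :+ con (+ 0) :* Δ :- c := v :- c)
              refl v Δ (chord h i j))))

      -- Multiplying by the positive span clears denominators. For `r i < 0#` the result compares
      -- slopes: `(h j - v) / r j` is at most `(h i - v) / r i`.
      chord≤⇒cross≤ : ∀ {h v} → chord h i j ≤ v → r j * (h i - v) ≤ r i * (h j - v)
      chord≤⇒cross≤ {h} {v} c≤v = ≤-by
        (*-nonNeg (0≤- c≤v) (proj₁ 0<span))
        (trans
          (solve 6 (λ a b x y v w →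
            (v :- (b :* w :* x :+ (:- a) :* w :* y)) :* (b :- a)
              := v :* (b :- a) :- ((b :- a) :* w) :* (b :* x :- a :* y))
            refl (r i) (r j) (h i) (h j) v w)
          (trans (+-congˡ (-‿cong (*-congʳ (*-inverseʳ _ (0<⇒≉0 0<span)))))
            (solve 5 (λ a b x y v →
              v :* (b :- a) :- con (+ 1) :* (b :* x :- a :* y) := a :* (y :- v) :- b :* (x :- v))
              refl (r i) (r j) (h i) (h j) v)))

    -- Δ is the supremum of the slopes (h j - v) / r j over r j > 0; the chord
    -- condition says that the slopes over r i < 0 are upper bounds of these.
    chords≤⇒superhedges : ∀ {h v} → ArbitrageFree →
      (∀ {i j} → Straddles i j → chord h i j ≤ v) → ∃[ Δ ] Superhedges D r h v Δ
    chords≤⇒superhedges {h} {v} ((i₀ , Di₀ , ri₀<0) , (j₀ , Dj₀ , 0<rj₀)) chords≤ =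
      Δ , superhedges
      where
      -- Downward closed and free of division, with the same supremum as the slopes themselves.
      Slope : Pred Carrier 0ℓ
      Slope s = ∃[ j ] (D j × 0# < r j) × s * r j ≤ h j - v

      0<-rᵢ : ∀ {i} → r i < 0# → 0# < - r i
      0<-rᵢ (rᵢ≤0 , rᵢ≉0) = ≤-respʳ-≈ (+-identityˡ _) (0≤- rᵢ≤0) , λ 0≈ →
        rᵢ≉0 (trans (solve 1 (λ a → a := :- (:- a)) refl _)
          (trans (-‿cong (sym 0≈)) (solve 0 (:- con (+ 0) := con (+ 0)) refl)))

      slope≤ : ∀ {i} → D i → r i < 0# → IsUpperBound Slope ((v - h i) / (- r i))
      slope≤ {i} Di ri<0 s (j , (Dj , 0<rj) , srj≤) =
        *-cancelʳ-≤ (0<-rᵢ ri<0) (≤-respʳ-≈ (sym (/-* (0<-rᵢ ri<0)))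
          (*-cancelʳ-≤ 0<rj (≤-by
            (0≤+ (*-nonNeg (proj₁ (0<-rᵢ ri<0)) (0≤- srj≤))
                 (0≤- (chord≤⇒cross≤ straddles (chords≤ straddles))))
            (solve 6 (λ a b x y v s →
              (:- a) :* (y :- v :- s :* b) :+ (a :* (y :- v) :- b :* (x :- v))
                := (v :- x) :* b :- s :* (:- a) :* b)
              refl (r i) (r j) (h i) (h j) v s))))
        where straddles = (Di , proj₁ ri<0) , (Dj , 0<rj)

      slope : ∀ {j} → D j → 0# < r j → Slope ((h j - v) / r j)
      slope {j} Dj 0<rj = j , (Dj , 0<rj) , ≤-reflexive (/-* 0<rj)

      sup-slope : ∃[ s ] IsUpperBound Slope s × (∀ b → IsUpperBound Slope b → s ≤ b)
      sup-slope = complete Slope (_ , slope Dj₀ 0<rj₀) (_ , slope≤ Di₀ ri₀<0)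
      Δ = proj₁ sup-slope

      right : ∀ {i} → D i → 0# < r i → h i ≤ v + r i * Δ
      right {i} Di 0<ri = ≤-by
        (0≤+ (*-nonNeg (proj₁ 0<ri) (0≤- (proj₁ (proj₂ sup-slope) _ (slope Di 0<ri))))
             (0≤- (≤-reflexive (sym (/-* 0<ri)))))
        (solve 5 (λ a x v Δ s → a :* (Δ :- s) :+ (s :* a :- (x :- v)) := v :+ a :* Δ :- x)
          refl (r i) (h i) v Δ ((h i - v) / r i))

      left : ∀ {i} → D i → r i < 0# → h i ≤ v + r i * Δ
      left {i} Di ri<0 = ≤-by
        (0≤+ (*-nonNeg (proj₁ (0<-rᵢ ri<0)) (0≤- (proj₂ (proj₂ sup-slope) _ (slope≤ Di ri<0))))
             (0≤- (≤-reflexive (/-* (0<-rᵢ ri<0)))))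
        (solve 5 (λ a x v Δ s →
          (:- a) :* (s :- Δ) :+ (v :- x :- s :* (:- a)) := v :+ a :* Δ :- x)
          refl (r i) (h i) v Δ ((v - h i) / (- r i)))

      -- Here `Δ` contributes nothing, but the chord from `i` to `j₀` has all its weight on `i`, so
      -- the chord condition already says `h i ≤ v`.
      middle : ∀ {i} → D i → r i ≈ 0# → h i ≤ v + r i * Δ
      middle {i} Di ri≈0 = ≤-respʳ-≈ (+-congˡ (sym (trans (*-congʳ ri≈0) (zeroˡ Δ))))
        (≤-respʳ-≈ (sym (+-identityʳ v)) (*-cancelʳ-≤ 0<rj₀ (≤-by
          (0≤- (chord≤⇒cross≤ straddles (chords≤ straddles)))
          (trans (+-congʳ (*-congʳ ri≈0))
            (solve 4 (λ b x y v → con (+ 0) :* (y :- v) :- b :* (x :- v) := v :* b :- x :* b)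
              refl (r j₀) (h i) (h j₀) v)))))
        where straddles = (Di , ≤-reflexive ri≈0) , (Dj₀ , 0<rj₀)

      superhedges : Superhedges D r h v Δ
      superhedges i Di = by-sign (r i ≤? 0#) (0# ≤? r i)
        where
        by-sign : Dec (r i ≤ 0#) → Dec (0# ≤ r i) → h i ≤ v + r i * Δ
        by-sign (no ri≰0)  _          = right Di (≰⇒> ri≰0)
        by-sign (yes _)    (no 0≰ri)  = left Di (≰⇒> 0≰ri)
        by-sign (yes ri≤0) (yes 0≤ri) = middle Di (antisym ri≤0 0≤ri)

    -- Strong duality: the price is the supremum of the chords. Every superhedge bounds them all,
    -- and at the supremum itself a superhedge exists. The given one ensures that the chords are
    -- bounded.
    superhedgingPrice : ∀ {h v₀ Δ₀} → ArbitrageFree → Superhedges D r h v₀ Δ₀ →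
      ∃[ v ] IsSuperhedgingPrice D r h v
    superhedgingPrice {h} {v₀} free@((i₀ , Di₀ , ri₀<0) , (j₀ , Dj₀ , 0<rj₀)) sh₀ =
      v , chords≤⇒superhedges free (λ {i} {j} str → proj₁ (proj₂ sup-chord) _ (i , j , str , refl)) ,
      λ v′ Δ sh → proj₂ (proj₂ sup-chord) v′ (chords≤ sh)
      where
      Chord : Pred Carrier 0ℓ
      Chord c = ∃[ i ] ∃[ j ] Straddles i j × c ≈ chord h i j

      chords≤ : ∀ {v Δ} → Superhedges D r h v Δ → IsUpperBound Chord v
      chords≤ sh c (i , j , str , c≈) = ≤-respˡ-≈ (sym c≈) (chord≤superhedge str sh)

      sup-chord : ∃[ s ] IsUpperBound Chord s × (∀ b → IsUpperBound Chord b → s ≤ b)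
      sup-chord = complete Chord
        (_ , i₀ , j₀ , ((Di₀ , proj₁ ri₀<0) , (Dj₀ , 0<rj₀)) , refl) (v₀ , chords≤ sh₀)
      v = proj₁ sup-chord

  -- Martingale measures on finitely many returns

  sum-mono-≤ : ∀ {n} {f g : Fin n → Carrier} → (∀ i → f i ≤ g i) → sum f ≤ sum g
  sum-mono-≤ {zero}          f≤g = ≤-refl
  sum-mono-≤ {suc n} {f} {g} f≤g = ≤-by
    (0≤+ (0≤- (f≤g zero)) (0≤- (sum-mono-≤ (λ i → f≤g (suc i)))))
    (solve 4 (λ a b c d → (b :- a) :+ (d :- c) := b :+ d :- (a :+ c))
      refl (f zero) (g zero) (sum (λ i → f (suc i))) (sum (λ i → g (suc i))))

  indicator : ∀ {n} → Fin n → Fin n → Carrier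
  indicator zero    zero    = 1#
  indicator zero    (suc _) = 0#
  indicator (suc _) zero    = 0#
  indicator (suc i) (suc k) = indicator i k

  0≤indicator : ∀ {n} (i k : Fin n) → 0# ≤ indicator i k
  0≤indicator zero    zero    = 0≤1
  0≤indicator zero    (suc _) = ≤-refl
  0≤indicator (suc _) zero    = ≤-refl
  0≤indicator (suc i) (suc k) = 0≤indicator i k

  sum-indicator : ∀ {n} (i : Fin n) (f : Fin n → Carrier) →
    sum (λ k → indicator i k * f k) ≈ f i
  sum-indicator {suc n} zero f = begin
    1# * f zero + sum (λ k → 0# * f (suc k))
      ≈⟨ +-cong (*-identityˡ _) (sum-cong-≋ (λ k → zeroˡ (f (suc k)))) ⟩
    f zero + sum {n} (λ _ → 0#)
      ≈⟨ +-congˡ (sum-replicate-zero n) ⟩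
    f zero + 0#
      ≈⟨ +-identityʳ _ ⟩
    f zero ∎
  sum-indicator (suc i) f =
    trans (+-cong (zeroˡ _) (sum-indicator i (λ k → f (suc k)))) (+-identityˡ _)

  module FiniteMarket {n} (û : Fin n → Carrier) where
    open TwoPoint U û

    -- Weak duality for all martingale measures: in the expectation of the superhedging inequality
    -- the `Δ` term vanishes with the mean.
    expectation≤superhedge : ∀ {P h v Δ} → IsMartingaleMeasure û P → Superhedges U û h v Δ →
      sum (λ i → P i * h i) ≤ v
    expectation≤superhedge {P} {h} {v} {Δ} ((0≤P , ∑P≈1) , mean≈0) sh =
      ≤-trans (sum-mono-≤ (λ i → *-monoˡ-≤ (0≤P i) (sh i _))) (≤-reflexive (begin
        sum (λ i → P i * (v + û i * Δ))
          ≈⟨ sum-cong-≋ (λ i → solve 4 (λ p v u Δ → p :* (v :+ u :* Δ) := p :* v :+ p :* u :* Δ)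
                                refl (P i) v (û i) Δ) ⟩
        sum (λ i → P i * v + P i * û i * Δ)
          ≈⟨ ∑-distrib-+ (λ i → P i * v) (λ i → P i * û i * Δ) ⟩
        sum (λ i → P i * v) + sum (λ i → P i * û i * Δ)
          ≈⟨ +-cong (*-distribʳ-sum v P) (*-distribʳ-sum Δ (λ i → P i * û i)) ⟨
        sum P * v + sum (λ i → P i * û i) * Δ
          ≈⟨ +-cong (*-congʳ ∑P≈1) (*-congʳ mean≈0) ⟩
        1# * v + 0# * Δ
          ≈⟨ solve 2 (λ v Δ → con (+ 1) :* v :+ con (+ 0) :* Δ := v) refl v Δ ⟩
        v ∎))

    twoPoint : Fin n → Fin n → Fin n → Carrier
    twoPoint i j k = weightˡ i j * indicator i k + weightʳ i j * indicator j k

    sum-twoPoint : ∀ i j h → sum (λ k → twoPoint i j k * h k) ≈ chord h i j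
    sum-twoPoint i j h = begin
      sum (λ k → twoPoint i j k * h k)
        ≈⟨ sum-cong-≋ (λ k → solve 5 (λ p q a b x →
             (p :* a :+ q :* b) :* x := p :* (a :* x) :+ q :* (b :* x))
             refl (weightˡ i j) (weightʳ i j) (indicator i k) (indicator j k) (h k)) ⟩
      sum (λ k → weightˡ i j * (indicator i k * h k) + weightʳ i j * (indicator j k * h k))
        ≈⟨ ∑-distrib-+ (λ k → weightˡ i j * (indicator i k * h k)) _ ⟩
      sum (λ k → weightˡ i j * (indicator i k * h k)) +
      sum (λ k → weightʳ i j * (indicator j k * h k))
        ≈⟨ +-cong (*-distribˡ-sum (weightˡ i j) (λ k → indicator i k * h k))
                  (*-distribˡ-sum (weightʳ i j) (λ k → indicator j k * h k)) ⟨
      weightˡ i j * sum (λ k → indicator i k * h k) +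
      weightʳ i j * sum (λ k → indicator j k * h k)
        ≈⟨ +-cong (*-congˡ (sum-indicator i h)) (*-congˡ (sum-indicator j h)) ⟩
      chord h i j ∎

    twoPoint-martingale : ∀ {i j} → Straddles i j → IsMartingaleMeasure û (twoPoint i j)
    twoPoint-martingale {i} {j} str =
      ( (λ k → 0≤+ (*-nonNeg (0≤weightˡ str) (0≤indicator i k))
                   (*-nonNeg (0≤weightʳ str) (0≤indicator j k)))
      , trans (sum-cong-≋ (λ k → sym (*-identityʳ (twoPoint i j k))))
          (trans (sum-twoPoint i j (λ _ → 1#))
            (trans (+-cong (*-identityʳ _) (*-identityʳ _)) (weights-sum str))) )
      , trans (sum-twoPoint i j û) (weights-mean str)

    -- The two-point measures make `v` a bound for all chords, so `v` suffices to superhedge; being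
    -- an expectation, it is at most any superhedging capital.
    max⇒price : ∀ {h v} → ArbitrageFree →
      IsMax (IsMartingaleMeasure û) (λ P → sum (λ i → P i * h i)) v →
      IsSuperhedgingPrice U û h v
    max⇒price {h} free ((P , mart , ≈v) , ≤v) =
      chords≤⇒superhedges free (λ {i} {j} str →
        ≤-respˡ-≈ (sum-twoPoint i j h) (≤v _ (twoPoint-martingale str))) ,
      λ v′ Δ sh → ≤-respˡ-≈ ≈v (expectation≤superhedge mart sh)

    straddles? : ∀ ((i , j) : Fin n × Fin n) → Dec (Straddles i j)
    straddles? (i , j) with û i ≤? 0# | û j ≤? 0#
    ... | no ûᵢ≰0  | _        = no λ str → ûᵢ≰0 (proj₂ (proj₁ str))
    ... | yes _    | yes ûⱼ≤0 = no λ str → <⇒≱ (proj₂ (proj₂ str)) ûⱼ≤0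
    ... | yes ûᵢ≤0 | no ûⱼ≰0  = yes ((_ , ûᵢ≤0) , (_ , ≰⇒> ûⱼ≰0))

    -- There are finitely many chords. The largest suffices to superhedge, hence bounds every
    -- expectation, and its two-point measure attains it.
    maxExpectation : ∀ h → ArbitrageFree →
      ∃[ v ] IsMax (IsMartingaleMeasure û) (λ P → sum (λ i → P i * h i)) v
    maxExpectation h free@((i₀ , _ , ûi₀<0) , (j₀ , _ , 0<ûj₀)) =
      value best , (twoPoint (proj₁ best) (proj₂ best) , twoPoint-martingale best-straddles
                   , sum-twoPoint (proj₁ best) (proj₂ best) h) ,
      λ P mart → expectation≤superhedge mart (proj₂ hedge)
      where
      value : Fin n × Fin n → Carrier
      value (i , j) = chord h i j
      pairs = filter straddles? (cartesianProduct (allFin n) (allFin n))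
      -- The default `(i₀ , j₀)` straddles as well, so `best` does in every case.
      best = argmax value (i₀ , j₀) pairs
      best-straddles : Straddles (proj₁ best) (proj₂ best)
      best-straddles = argmax-all value {P = λ (i , j) → Straddles i j}
        ((_ , proj₁ ûi₀<0) , (_ , 0<ûj₀))
        (all-filter straddles? (cartesianProduct (allFin n) (allFin n)))
      hedge : ∃[ Δ ] Superhedges U û h (value best) Δ
      hedge = chords≤⇒superhedges free λ {i} {j} str →
        All.lookup (f[xs]≤f[argmax] {f = value} (i₀ , j₀) pairs)
          (∈-filter⁺ straddles? (∈-cartesianProduct⁺ (∈-allFin i) (∈-allFin j)) str)

-- Backward induction

module BackwardInduction (ℝ : RealNumbers) where
  open RealNumbers ℝ hiding (zero)

  -- `IsUpperBoundPrice` and `IsTreePrice` are instances by definition, `Step f x v` saying that `v`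
  -- is the continuation value at `x`.
  Recursion : ((Carrier → Carrier) → Carrier → Carrier → Set) → (Carrier → Carrier) → ℕ →
    (ℕ → Carrier → Carrier) → Set
  Recursion Step g τ G =
    (∀ x → G τ x ≈ g x) ×
    (∀ t → t ℕ.< τ → ∀ x → ∃[ v ] Step (G (suc t)) x v × G t x ≈ v ⊔ g x)

  -- `Inv` carries the regularity that makes the next step solvable. `stage k` is the value function
  -- with `k` steps remaining, so time `t` is stage `τ ∸ t`.
  recursion-solvable : ∀ {Step g} (Inv : (Carrier → Carrier) → Set) → Inv g →
    (∀ {f} → Inv f → ∀ x → ∃[ v ] Step f x v) →
    (∀ {f f′} → Inv f → (∀ x → ∃[ v ] Step f x v × f′ x ≈ v ⊔ g x) → Inv f′) →
    ∀ τ → ∃[ G ] Recursion Step g τ G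
  recursion-solvable {Step} {g} Inv inv-g solve-step preserves τ =
    (λ t → proj₁ (stage (τ ℕ.∸ t))) ,
    (λ x → reflexive (≡.cong (λ k → proj₁ (stage k) x) (ℕ.n∸n≡0 τ))) ,
    steps
    where
    next : ∃[ f ] Inv f → Carrier → Carrier
    next (f , inv) x = proj₁ (solve-step inv x) ⊔ g x

    stage : ℕ → ∃[ f ] Inv f
    stage zero    = g , inv-g
    stage (suc k) = next (stage k) ,
      preserves (proj₂ (stage k)) (λ x → _ , proj₂ (solve-step (proj₂ (stage k)) x) , refl)

    steps : ∀ t → t ℕ.< τ → ∀ x → ∃[ v ]
      Step (proj₁ (stage (τ ℕ.∸ suc t))) x v × proj₁ (stage (τ ℕ.∸ t)) x ≈ v ⊔ g x
    steps t (ℕ.s≤s t≤τ′) x = proj₁ solution , proj₂ solution ,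
      reflexive (≡.cong (λ k → proj₁ (stage k) x) (ℕ.+-∸-assoc 1 t≤τ′))
      where solution = solve-step (proj₂ (stage (τ ℕ.∸ suc t))) x

  -- P k t is a property of the time t at which k steps remain.
  descend : ∀ (P : ℕ → ℕ → Set) τ → P 0 τ →
    (∀ k t → t ℕ.< τ → P k (suc t) → P (suc k) t) → P τ 0
  descend P τ base step = go τ 0 (ℕ.+-identityʳ τ)
    where
    go : ∀ k t → k ℕ.+ t ≡ τ → P k t
    go zero    t ≡.refl = base
    go (suc k) t ≡.refl = step k t (ℕ.s≤s (ℕ.m≤n+m t k)) (go k (suc t) (ℕ.+-suc k t))

-- Prices over the interval of returns

module Pricing (ℝ : RealNumbers) where
  open RealNumbers ℝ hiding (zero)
  open AmericanOption ℝ
  open OrderedField ℝ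
  open Duality ℝ
  open BackwardInduction ℝ

  module UpperBound {L ζ₋ ζ₊ g}
    (0<ζ₋ : 0# < ζ₋) (ζ₋≤1 : ζ₋ ≤ 1#) (0<ζ₊ : 0# < ζ₊)
    (0≤L : 0# ≤ L) (lip-g : LipschitzBound L g) where

    𝒰 : Pred Carrier 0ℓ
    𝒰 = Interval (- ζ₋) ζ₊

    -ζ₋≤ : ∀ {x} → 0# ≤ x → - ζ₋ ≤ x
    -ζ₋≤ {x} 0≤x = ≤-by (0≤+ 0≤x (proj₁ 0<ζ₋))
      (solve 2 (λ z x → x :+ z := x :- (:- z)) refl ζ₋ x)

    -- Here `ζ₋ ≤ 1#` enters: nonnegative asset prices stay nonnegative.
    0≤1+R : ∀ {R} → 𝒰 R → 0# ≤ 1# + R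
    0≤1+R {R} (-ζ₋≤R , _) = ≤-by (0≤+ (0≤- ζ₋≤1) (0≤- -ζ₋≤R))
      (solve 2 (λ z R → (con (+ 1) :- z) :+ (R :- (:- z)) := con (+ 1) :+ R :- con (+ 0)) refl ζ₋ R)

    open TwoPoint 𝒰 (λ R → R)

    -ζ₋<0 : - ζ₋ < 0#
    -ζ₋<0 = ≰⇒> λ 0≤-ζ₋ → <⇒≱ 0<ζ₋
      (≤-by 0≤-ζ₋ (solve 1 (λ z → :- z := con (+ 0) :- z) refl ζ₋))

    𝒰-arbitrageFree : ArbitrageFree
    𝒰-arbitrageFree =
      (- ζ₋ , (≤-refl , -ζ₋≤ (proj₁ 0<ζ₊)) , -ζ₋<0) ,
      (ζ₊ , (-ζ₋≤ (proj₁ 0<ζ₊) , ≤-refl) , 0<ζ₊)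

    MinMaxStep : (Carrier → Carrier) → Carrier → Carrier → Set
    MinMaxStep f x v = IsMinMax U 𝒰 (λ Δ R → f (x * (1# + R)) - R * Δ) v

    Price : (Carrier → Carrier) → Carrier → Carrier → Set
    Price f x = IsSuperhedgingPrice 𝒰 (λ R → R) (λ R → f (x * (1# + R)))

    -- Moving `R` by `d` moves `x * (1# + R)` by `∣ x ∣ * d` and `R * Δ` by `∣ Δ ∣ * d`.
    payoff-lipschitz : ∀ {f} → LipschitzBound L f → ∀ x Δ →
      LipschitzBound (L * ∣ x ∣ + ∣ Δ ∣) (λ R → f (x * (1# + R)) - R * Δ)
    payoff-lipschitz {f} lip x Δ {R} {R′} {d} 0≤d near = ≤-by
      (0≤+ (0≤- (lip (*-nonNeg (0≤∣x∣ x) 0≤d) (near-*ˡ x (near-+ˡ 1# near))))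
           (0≤- (proj₂ (near-*ˡ Δ near))))
      (solve 9 (λ a b L X D d Δ R S →
        (b :+ L :* (X :* d) :- a) :+ (Δ :* R :+ D :* d :- Δ :* S)
          := b :- S :* Δ :+ (L :* X :+ D) :* d :- (a :- R :* Δ))
        refl (f (x * (1# + R))) (f (x * (1# + R′))) L ∣ x ∣ ∣ Δ ∣ d Δ R R′)

    minMaxStep-solvable : ∀ {f} → LipschitzBound L f → ∀ x → ∃[ v ] MinMaxStep f x v
    minMaxStep-solvable {f} lip x = _ , price⇒minMax argmax (proj₂ price)
      where
      argmax : ∀ Δ → ∃[ R ] 𝒰 R ×
        (∀ R′ → 𝒰 R′ → f (x * (1# + R′)) - R′ * Δ ≤ f (x * (1# + R)) - R * Δ)
      argmax Δ = lipschitz-attains-max (0≤+ (*-nonNeg 0≤L (0≤∣x∣ x)) (0≤∣x∣ Δ))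
        (payoff-lipschitz lip x Δ) (-ζ₋≤ (proj₁ 0<ζ₊))
      price : ∃[ v ] Price f x v
      -- The initial superhedge holds no asset: position `0#`, with the maximal payoff as capital.
      price = superhedgingPrice 𝒰-arbitrageFree
        (bounded⇒superhedges {h = λ R → f (x * (1# + R))} (proj₂ (proj₂ (argmax 0#))))

    -- A superhedge (v , Δ) at y is one at x after adding L d to both v and Δ,
    -- because f (x (1 + R)) ≤ f (y (1 + R)) + L d (1 + R).
    step-lipschitz : ∀ {f f′} → LipschitzBound L f →
      (∀ x → ∃[ v ] MinMaxStep f x v × f′ x ≈ v ⊔ g x) → LipschitzBound L f′
    step-lipschitz {f} {f′} lip step {x} {y} {d} 0≤d near =
      ≤-respˡ-≈ (sym f′x≈) (≤-respʳ-≈ (+-congʳ (sym f′y≈))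
        (⊔-lub (≤-trans vx≤ (+-monoˡ-≤ (x≤x⊔y vy (g y))))
               (≤-trans (lip-g 0≤d near) (+-monoˡ-≤ (x≤y⊔x vy (g y))))))
      where
      vx = proj₁ (step x)
      vy = proj₁ (step y)
      f′x≈ = proj₂ (proj₂ (step x))
      f′y≈ = proj₂ (proj₂ (step y))

      price-x : Price f x vx
      price-x = minMax⇒price (proj₁ (proj₂ (step x)))

      price-y : Price f y vy
      price-y = minMax⇒price (proj₁ (proj₂ (step y)))

      Δ = proj₁ (proj₁ price-y)

      vx≤ : vx ≤ vy + L * d
      vx≤ = proj₂ price-x (vy + L * d) (Δ + L * d) λ R R∈𝒰 → ≤-by
        (0≤+ (0≤- (lip (*-nonNeg 0≤d (0≤1+R R∈𝒰)) (near-*ʳ (0≤1+R R∈𝒰) near)))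
             (0≤- (proj₂ (proj₁ price-y) R R∈𝒰)))
        (solve 7 (λ a b L d R v Δ →
          (b :+ L :* (d :* (con (+ 1) :+ R)) :- a) :+ (v :+ R :* Δ :- b)
            := v :+ L :* d :+ R :* (Δ :+ L :* d) :- a)
          refl (f (x * (1# + R))) (f (y * (1# + R))) L d R vy Δ)

    -- Buying `L` units of the asset superhedges: capital and position `L * x` grow to
    -- `L * (x * (1# + R))`.
    price≤linear : ∀ {f x v} → (∀ {y} → 0# ≤ y → f y ≤ L * y) → 0# ≤ x → Price f x v → v ≤ L * x
    price≤linear {f} {x} f≤ 0≤x (_ , minimal) = minimal (L * x) (L * x) λ R R∈𝒰 →
      ≤-respʳ-≈ (solve 3 (λ L x R → L :* (x :* (con (+ 1) :+ R)) := L :* x :+ R :* (L :* x)) refl L x R)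
        (f≤ (*-nonNeg 0≤x (0≤1+R R∈𝒰)))

    -- Prices on the grid and their comparison with the interval

    module Tree {ε : Carrier} {N′ : ℕ} (0<ε : 0# < ε)
      (Nε≈ : fromℕ (suc N′) * ε ≈ ζ₋ + ζ₊) where

      N = suc N′

      û : Fin (suc N) → Carrier
      û = grid (- ζ₋) ε N

      -ζ₋+Nε≈ζ₊ : - ζ₋ + fromℕ N * ε ≈ ζ₊
      -ζ₋+Nε≈ζ₊ = trans (+-congˡ Nε≈) (solve 2 (λ z y → :- z :+ (z :+ y) := y) refl ζ₋ ζ₊)

      û∈𝒰 : ∀ i → 𝒰 (û i)
      û∈𝒰 i =
        ≤-by (*-nonNeg (0≤fromℕ (toℕ i)) (proj₁ 0<ε))
          (solve 2 (λ z y → y := :- z :+ y :- (:- z)) refl ζ₋ (fromℕ (toℕ i) * ε)) ,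
        ≤-respʳ-≈ -ζ₋+Nε≈ζ₊ (≤-by
          (*-nonNeg (0≤- (fromℕ-mono-≤ (ℕ.s≤s⁻¹ (toℕ<n i)))) (proj₁ 0<ε))
          (solve 4 (λ z m n e → (n :- m) :* e := :- z :+ n :* e :- (:- z :+ m :* e))
            refl ζ₋ (fromℕ (toℕ i)) (fromℕ N) ε))

      û-fromℕ< : ∀ {k} (k<1+N : k ℕ.< suc N) → û (fromℕ< k<1+N) ≈ - ζ₋ + fromℕ k * ε
      û-fromℕ< k<1+N = reflexive (≡.cong (λ k → - ζ₋ + fromℕ k * ε) (toℕ-fromℕ< k<1+N))

      û-arbitrageFree : TwoPoint.ArbitrageFree U û
      û-arbitrageFree =
        (zero , _ , ≰⇒> λ 0≤û → <⇒≱ -ζ₋<0 (≤-respʳ-≈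
          (solve 2 (λ z e → :- z :+ con (+ 0) :* e := :- z) refl ζ₋ ε) 0≤û)) ,
        (fromℕ< (ℕ.n<1+n N) , _ , <-≤-trans 0<ζ₊
          (≤-reflexive (sym (trans (û-fromℕ< (ℕ.n<1+n N)) -ζ₋+Nε≈ζ₊))))

      bracket : ∀ n {R} → - ζ₋ ≤ R → R ≤ - ζ₋ + fromℕ (suc n) * ε →
        ∃[ k ] k ℕ.≤ n × - ζ₋ + fromℕ k * ε ≤ R × R ≤ - ζ₋ + fromℕ (suc k) * ε
      bracket zero {R} lo hi = 0 , ℕ.z≤n ,
        ≤-respˡ-≈ (solve 2 (λ z e → :- z := :- z :+ con (+ 0) :* e) refl ζ₋ ε) lo , hi
      bracket (suc n) {R} lo hi with R ≤? (- ζ₋ + fromℕ (suc n) * ε)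
      ... | no R≰ = suc n , ℕ.≤-refl , ≰⇒≥ R≰ , hi
      ... | yes R≤ = let (k , k≤n , bounds) = bracket n lo R≤ in k , ℕ.m≤n⇒m≤1+n k≤n , bounds

      -- Of the two grid points around R, one is not worse than R for the
      -- linear function with slope Δ.
      gridPoint : ∀ {R} → 𝒰 R → ∀ Δ → ∃[ i ] Near ε R (û i) × û i * Δ ≤ R * Δ
      gridPoint {R} (lo , hi) Δ = choose (bracket N′ lo (≤-respʳ-≈ (sym -ζ₋+Nε≈ζ₊) hi)) (total 0# Δ)
        where
        choose : ∃[ k ] k ℕ.≤ N′ × - ζ₋ + fromℕ k * ε ≤ R × R ≤ - ζ₋ + fromℕ (suc k) * ε →
          0# ≤ Δ ⊎ Δ ≤ 0# → ∃[ i ] Near ε R (û i) × û i * Δ ≤ R * Δ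
        -- The left end of the cell serves for `0# ≤ Δ`, the right end for `Δ ≤ 0#`; the latter has
        -- index `suc k`, which is at most `N` because `k ≤ N′`.
        choose (k , k≤N′ , below , above) (inj₁ 0≤Δ) = fromℕ< k<1+N ,
          ( ≤-by (0≤- above)
              (trans (solve 4 (λ z m e R → :- z :+ (con (+ 1) :+ m) :* e :- R
                       := :- z :+ m :* e :+ e :- R) refl ζ₋ (fromℕ k) ε R)
                (+-congʳ (+-congʳ (sym û≈))))
          , ≤-respˡ-≈ (sym û≈) (≤-by (0≤+ (0≤- below) (proj₁ 0<ε))
              (solve 3 (λ u e R → R :- u :+ e := R :+ e :- u) refl (- ζ₋ + fromℕ k * ε) ε R)) ) ,
          ≤-by (*-nonNeg (0≤- (≤-respˡ-≈ (sym û≈) below)) 0≤Δ)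
            (solve 3 (λ u R Δ → (R :- u) :* Δ := R :* Δ :- u :* Δ) refl (û (fromℕ< k<1+N)) R Δ)
          where
          k<1+N = ℕ.s≤s (ℕ.m≤n⇒m≤1+n k≤N′)
          û≈ = û-fromℕ< k<1+N
        choose (k , k≤N′ , below , above) (inj₂ Δ≤0) = fromℕ< k+1<1+N ,
          ( ≤-trans (≤-respʳ-≈ (sym û≈) above)
              (≤-by (proj₁ 0<ε) (solve 2 (λ u e → e := u :+ e :- u) refl (û (fromℕ< k+1<1+N)) ε))
          , ≤-by (0≤- below)
              (trans (solve 4 (λ z m e R → R :- (:- z :+ m :* e)
                       := R :+ e :- (:- z :+ (con (+ 1) :+ m) :* e)) refl ζ₋ (fromℕ k) ε R)
                (+-congˡ (-‿cong (sym û≈)))) ) ,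
          ≤-by (*-nonNeg (0≤- (≤-respʳ-≈ (sym û≈) above)) (0≤- Δ≤0))
            (solve 3 (λ u R Δ → (u :- R) :* (con (+ 0) :- Δ) := R :* Δ :- u :* Δ)
              refl (û (fromℕ< k+1<1+N)) R Δ)
          where
          k+1<1+N = ℕ.s≤s (ℕ.s≤s k≤N′)
          û≈ = û-fromℕ< k+1<1+N

      TreePrice : (Carrier → Carrier) → Carrier → Carrier → Set
      TreePrice f x = IsSuperhedgingPrice U û (λ i → f (x * (1# + û i)))

      -- Grid points lie in `𝒰`, so a superhedge on the interval is one on the grid.
      treePrice≤price : ∀ {f f̂ x v v̂} → (∀ y → f̂ y ≤ f y) →
        Price f x v → TreePrice f̂ x v̂ → v̂ ≤ v
      treePrice≤price f̂≤f ((Δ , sh) , _) (_ , minimal) =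
        minimal _ Δ λ i _ → ≤-trans (f̂≤f _) (sh (û i) (û∈𝒰 i))

      price≤treePrice : ∀ {f f̂ κ x v v̂} → LipschitzBound L f → 0# ≤ x →
        (∀ {y} → 0# ≤ y → f y ≤ f̂ y + κ * y) →
        Price f x v → TreePrice f̂ x v̂ → v ≤ v̂ + (κ + L * ε) * x
      price≤treePrice {f} {f̂} {κ} {x} {v} {v̂} lip 0≤x f≤f̂ (_ , minimal) ((Δ , sh) , _) =
        -- The excess `κ * y` at `y = x * (1# + û i)` is hedged by capital and position `κ * x`.
        -- This changes the position, so the grid point is chosen for `Δ + κ * x` instead of `Δ`.
        minimal _ (Δ + κ * x) λ R R∈𝒰 →
          let (i , near , ûΔ≤RΔ) = gridPoint R∈𝒰 (Δ + κ * x)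
              h = f̂ (x * (1# + û i))
          in ≤-by
            (0≤+ (0≤- (lip (*-nonNeg 0≤x (proj₁ 0<ε)) (near-nonNeg-*ˡ 0≤x (near-+ˡ 1# near))))
              (0≤+ (0≤- (f≤f̂ (*-nonNeg 0≤x (0≤1+R (û∈𝒰 i)))))
                (0≤+ (0≤- (sh i _)) (0≤- ûΔ≤RΔ))))
            (solve 11 (λ fR fu h v Δ κ x L e R u →
              (fu :+ L :* (x :* e) :- fR) :+
              ((h :+ κ :* (x :* (con (+ 1) :+ u)) :- fu) :+
              ((v :+ u :* Δ :- h) :+ (R :* (Δ :+ κ :* x) :- u :* (Δ :+ κ :* x))))
                := v :+ (κ :+ L :* e) :* x :+ R :* (Δ :+ κ :* x) :- fR)
              refl (f (x * (1# + R))) (f (x * (1# + û i))) h v̂ Δ κ x L ε R (û i))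

      upperBoundPrice-exists : ∀ τ → ∃[ G ] IsUpperBoundPrice g 𝒰 τ G
      upperBoundPrice-exists =
        recursion-solvable (LipschitzBound L) lip-g minMaxStep-solvable step-lipschitz

      -- The invariant is trivial: on a finite grid the maximal expectation is attained for every
      -- function.
      treePrice-exists : ∀ τ → ∃[ Ĝ ] IsTreePrice g û τ Ĝ
      treePrice-exists = recursion-solvable
        {Step = λ f x → IsMax (IsMartingaleMeasure û) (λ P → 𝔼 û P (λ R → f (x * (1# + R))))}
        (λ _ → ⊤) _
        (λ {f} _ x → FiniteMarket.maxExpectation û (λ i → f (x * (1# + û i))) û-arbitrageFree) _

      module _ {τ G Ĝ} (isG : IsUpperBoundPrice g 𝒰 τ G) (isĜ : IsTreePrice g û τ Ĝ) where

        price-step : ∀ t → t ℕ.< τ → ∀ x → ∃[ v ] Price (G (suc t)) x v × G t x ≈ v ⊔ g x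
        price-step t t<τ x = let (v , step , Gx≈) = proj₂ isG t t<τ x in
          v , minMax⇒price {r = λ R → R} {h = λ R → G (suc t) (x * (1# + R))} step , Gx≈

        treePrice-step : ∀ t → t ℕ.< τ → ∀ x →
          ∃[ v ] TreePrice (Ĝ (suc t)) x v × Ĝ t x ≈ v ⊔ g x
        treePrice-step t t<τ x = let (v , step , Ĝx≈) = proj₂ isĜ t t<τ x in
          v , FiniteMarket.max⇒price û û-arbitrageFree step , Ĝx≈

        Ĝ≤G : ∀ x → Ĝ 0 x ≤ G 0 x
        Ĝ≤G = descend (λ _ t → ∀ x → Ĝ t x ≤ G t x) τ
          (λ x → ≤-reflexive (trans (proj₁ isĜ x) (sym (proj₁ isG x))))
          λ _ t t<τ Ĝ≤G x →
            let (v , price , Gx≈) = price-step t t<τ x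
                (v̂ , treePrice , Ĝx≈) = treePrice-step t t<τ x
            in ≤-respˡ-≈ (sym Ĝx≈) (≤-respʳ-≈ (sym Gx≈) (⊔-lub
                 (≤-trans (treePrice≤price {G (suc t)} {Ĝ (suc t)} Ĝ≤G price treePrice) (x≤x⊔y v (g x)))
                 (x≤y⊔x v (g x))))

        lip-Gτ : LipschitzBound L (G τ)
        lip-Gτ {x} {y} 0≤d near = ≤-respˡ-≈ (sym (proj₁ isG x))
          (≤-respʳ-≈ (+-congʳ (sym (proj₁ isG y))) (lip-g 0≤d near))

        -- The induction also carries the Lipschitz bound on `G t`, which controls the
        -- discretisation cost `L * ε * x` of the next step.
        G≤Ĝ+error : ∀ {x} → 0# ≤ x → G 0 x ≤ Ĝ 0 x + fromℕ τ * (L * ε) * x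
        G≤Ĝ+error = proj₂ (descend
          (λ k t → LipschitzBound L (G t) ×
                   (∀ {x} → 0# ≤ x → G t x ≤ Ĝ t x + fromℕ k * (L * ε) * x)) τ
          (lip-Gτ , λ {x} _ → ≤-reflexive (trans (proj₁ isG x) (trans (sym (proj₁ isĜ x))
            (solve 3 (λ a b x → a := a :+ con (+ 0) :* b :* x) refl (Ĝ τ x) (L * ε) x))))
          λ k t t<τ (lip , G≤Ĝ) → step-lipschitz lip (proj₂ isG t t<τ) , λ {x} 0≤x →
            let (v , price , Gx≈) = price-step t t<τ x
                (v̂ , treePrice , Ĝx≈) = treePrice-step t t<τ x
                error≈ = solve 3 (λ m b x → (m :* b :+ b) :* x := (con (+ 1) :+ m) :* b :* x)
                           refl (fromℕ k) (L * ε) x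
                0≤error = *-nonNeg (*-nonNeg (0≤fromℕ (suc k)) (*-nonNeg 0≤L (proj₁ 0<ε))) 0≤x
            in ≤-respˡ-≈ (sym Gx≈) (≤-respʳ-≈ (+-congʳ (sym Ĝx≈)) (⊔-lub
                 (≤-trans
                   (≤-respʳ-≈ (+-congˡ error≈)
                     (price≤treePrice {G (suc t)} {Ĝ (suc t)} lip 0≤x G≤Ĝ price treePrice))
                   (+-monoˡ-≤ (x≤x⊔y v̂ (g x))))
                 -- The exercise value is the same on both sides, so nonnegativity of the error is
                 -- enough.
                 (≤-trans (x≤y⊔x v̂ (g x))
                   (≤-by 0≤error (solve 2 (λ a e → e := a :+ e :- a) refl _ _))))))

        G≤linear : (∀ {x} → 0# ≤ x → g x ≤ L * x) → ∀ {x} → 0# ≤ x → G 0 x ≤ L * x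
        G≤linear g≤ = descend (λ _ t → ∀ {x} → 0# ≤ x → G t x ≤ L * x) τ
          (λ {x} 0≤x → ≤-respˡ-≈ (sym (proj₁ isG x)) (g≤ 0≤x))
          λ _ t t<τ G≤ {x} 0≤x →
            let (v , price , Gx≈) = price-step t t<τ x
            in ≤-respˡ-≈ (sym Gx≈) (⊔-lub (price≤linear {G (suc t)} G≤ 0≤x price) (g≤ 0≤x))

        g≤Ĝ : 1 ℕ.≤ τ → ∀ x → g x ≤ Ĝ 0 x
        g≤Ĝ 1≤τ x = let (v , _ , Ĝx≈) = treePrice-step 0 1≤τ x in
          ≤-respʳ-≈ (sym Ĝx≈) (x≤y⊔x v (g x))

  -- The error for the prescribed step size

  module ErrorBound {δ L : Carrier} {τ : ℕ} (0<δ : 0# < δ) (0<L : 0# < L) (1≤τ : 1 ℕ.≤ τ) where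

    1≤fromℕτ : 1# ≤ fromℕ τ
    1≤fromℕτ = ≤-respˡ-≈ (+-identityʳ 1#) (fromℕ-mono-≤ 1≤τ)

    0<T : 0# < fromℕ τ
    0<T = <-≤-trans 0<1 1≤fromℕτ

    -- The factor `1#` is the constant `c`, kept so that this is literally the step in the theorem.
    ε : Carrier
    ε = (1# * δ ^ 2) / (L ^ 2 * fromℕ τ ^ 2)

    0<^2 : ∀ {x} → 0# < x → 0# < x ^ 2
    0<^2 0<x = 0<* 0<x (0<* 0<x 0<1)

    0<L²T² : 0# < L ^ 2 * fromℕ τ ^ 2
    0<L²T² = 0<* (0<^2 0<L) (0<^2 0<T)

    0<ε : 0# < ε
    0<ε = 0<* (0<* 0<1 (0<^2 0<δ)) (0<⁻¹ 0<L²T²)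

    -- (τ L ε) (L τ) = δ² ≤ δ (L τ)
    τLε≤δ : δ ≤ L → fromℕ τ * (L * ε) ≤ δ
    τLε≤δ δ≤L = *-cancelʳ-≤ (0<* 0<L 0<T) (≤-respˡ-≈ (sym τLε*Lτ≈δ²)
      (*-monoˡ-≤ (proj₁ 0<δ) (≤-trans δ≤L (≤-by (*-nonNeg (proj₁ 0<L) (0≤- 1≤fromℕτ))
        (solve 2 (λ L T → L :* (T :- con (+ 1)) := L :* T :- L) refl L (fromℕ τ))))))
      where
      τLε*Lτ≈δ² : fromℕ τ * (L * ε) * (L * fromℕ τ) ≈ δ * δ
      τLε*Lτ≈δ² = trans
        (solve 3 (λ T L e → T :* (L :* e) :* (L :* T)
          := e :* ((L :* (L :* con (+ 1))) :* (T :* (T :* con (+ 1))))) refl (fromℕ τ) L ε)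
        (trans (/-* 0<L²T²)
          (solve 1 (λ d → con (+ 1) :* (d :* (d :* con (+ 1))) := d :* d) refl δ))

corollary5p3 : (ℝ : RealNumbers) →
    let open RealNumbers ℝ
        open AmericanOption ℝ
    in
    Σ[ c ∈ Carrier ] (0# < c) ×
    (∀ (δ S₀ L ζ₋ ζ₊ : Carrier) (τ N : ℕ) (g : Carrier → Carrier) →
      0# < δ → 1 ℕ.≤ τ → 0# < S₀ → 0# < L →
      0# < ζ₋ → ζ₋ ≤ 1# → 0# < ζ₊ →
      NonDecreasing g → g 0# ≈ 0# → Lipschitz L g →
      let 𝒰 = Interval (- ζ₋) ζ₊
          ε = (c * δ ^ 2) / (L ^ 2 * fromℕ τ ^ 2)
          û = grid (- ζ₋) ε N
      in
      1 ℕ.≤ N → (ζ₋ + ζ₊) / ε ≈ fromℕ N →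
      -- both recursions have solutions (the maxima and minima are attained) ...
      (∃[ G ] IsUpperBoundPrice g 𝒰 τ G) ×
      (∃[ Ĝ ] IsTreePrice g û τ Ĝ) ×
      -- ... and, the solutions being unique, g_0 = G 0 and ĝ_0 = Ĝ 0 below
      (∀ G Ĝ → IsUpperBoundPrice g 𝒰 τ G → IsTreePrice g û τ Ĝ →
        (G 0 S₀ - δ * S₀ ≤ Ĝ 0 S₀) × (Ĝ 0 S₀ ≤ G 0 S₀)))
corollary5p3 ℝ = 1# , 0<1 , λ where
    δ S₀ L ζ₋ ζ₊ τ (suc N′) g 0<δ 1≤τ (0≤S₀ , _) 0<L 0<ζ₋ ζ₋≤1 0<ζ₊ g-mono g0≈0 lip _ N≈ →
      let open ErrorBound 0<δ 0<L 1≤τ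
          lip-g = lipschitz⇒bound {f = g} (proj₁ 0<L) lip
          open UpperBound {g = g} 0<ζ₋ ζ₋≤1 0<ζ₊ (proj₁ 0<L) lip-g
          open Tree {N′ = N′} 0<ε (trans (*-congʳ (sym N≈)) (/-* 0<ε))
          -- The Lipschitz bound is applied to `x` and `0#`, at distance `x`.
          g≤linear : ∀ {x} → 0# ≤ x → g x ≤ L * x
          g≤linear {x} 0≤x = ≤-respʳ-≈
            (trans (+-congʳ g0≈0) (+-identityˡ _))
            (lip-g 0≤x (≤-reflexive (sym (+-identityˡ x)) , 0≤+ 0≤x 0≤x))
      in upperBoundPrice-exists τ , treePrice-exists τ , λ G Ĝ isG isĜ →
        [ (λ δ≤L → ≤-by
            (0≤+ (0≤- (G≤Ĝ+error isG isĜ 0≤S₀)) (*-nonNeg (0≤- (τLε≤δ δ≤L)) 0≤S₀))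
            (solve 5 (λ G Ĝ e δ S → (Ĝ :+ e :* S :- G) :+ (δ :- e) :* S := Ĝ :- (G :- δ :* S))
              refl (G 0 S₀) (Ĝ 0 S₀) (fromℕ τ * (L * ε)) δ S₀))
        , (λ L≤δ → ≤-by
            -- Monotonicity of `g` enters here, through `g 0# ≤ g S₀`.
            (0≤+ (0≤- (≤-trans (≤-respˡ-≈ g0≈0 (g-mono 0≤S₀)) (g≤Ĝ isG isĜ 1≤τ S₀)))
              (0≤+ (0≤- (G≤linear isG isĜ g≤linear 0≤S₀)) (*-nonNeg (0≤- L≤δ) 0≤S₀)))
            (solve 5 (λ G Ĝ L δ S →
              (Ĝ :- con (+ 0)) :+ ((L :* S :- G) :+ (δ :- L) :* S) := Ĝ :- (G :- δ :* S))
              refl (G 0 S₀) (Ĝ 0 S₀) L δ S₀)) ]′ (total δ L) ,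
        Ĝ≤G isG isĜ S₀
  where
  open RealNumbers ℝ hiding (zero)
  open OrderedField ℝ
  open Pricing ℝ
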